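{- There exists a punctual structure $A$ which is computably categorical but not punctually categorical, such that $\mathrm{PRCatSpec}(A)\nsubseteq\mathrm{Cone}(\Delta^0_1)$.
   Context: A punctual structure is a structure with domain $\omega$ whose operations and relations are uniformly primitive recursive. A computable structure $A$ is computably categorical if between any two computable presentations of $A$ there is a computable isomorphism. Two punctual structures are punctually isomorphic if there is an isomorphism $f$ between them such that both $f$ and $f^{ -1}$ are primitive recursive; a punctual structure $A$ is punctually categorical if every punctual structure $B\cong A$ is punctually isomorphic to $A$. For total functions $f,g:\omega\to\omega$, write $f\leq_{PR} g$ if there is a primitive recursive scheme $\Psi$ (a primitive recursive definition which may additionally use the oracle function as a basic function) with $\Psi^{g}=f$. Write $f\equiv_{PR}g$ if $f\leq_{PR}g$ and $g\leq_{PR}f$. The $\equiv_{PR}$-classes are the PR-degrees, ordered by $\leq_{PR}$. For a punctual structure $A$, $\mathrm{PRCatSpec}(A)$ is the set of all PR-degrees $\mathbf d$ such that for every punctual structure $B\cong A$ there is an isomorphism $f:A\to B$ with $f\leq_{PR}\mathbf d$ and $f^{ -1}\leq_{PR}\mathbf d$. $\mathrm{Cone}(\Delta^0_1)$ is the set of all PR-degrees $\mathbf d$ such that $f\leq_{PR}\mathbf d$ for every total $\Delta^0_1$ (i.e. computable) function $f:\omega\to\omega$. -}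

module Defs where

open import Data.Bool.Base using (Bool; if_then_else_)
open import Data.Empty using (⊥; ⊥-elim)
open import Data.Fin.Base using (Fin; toℕ)
open import Data.Nat.Base using (ℕ; zero; suc; _+_; _<_)
open import Data.Product using (Σ; ∃; ∃-syntax; _×_; _,_)
open import Data.Unit.Base using (⊤; tt)
open import Data.Vec.Base using (Vec; []; _∷_; lookup; head; map)
open import Data.Vec.Relation.Binary.Pointwise.Inductive using (Pointwise)
open import Function.Base using (_∘_; const; id)
open import Function.Bundles using (_↔_; Inverse)
open import Level using (0ℓ)
open import Relation.Binary.Bundles using (Setoid)
open import Relation.Binary.Definitions using (_Respects_)
open import Relation.Binary.PropositionalEquality
  using (_≡_; refl; sym; trans; cong; cong₂)
open import Relation.Unary using (Pred)

open Inverse using (to; from)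

------------------------------------------------------------------------
-- Primitive recursive schemes

-- O is a set of names for unary oracles: O = ⊥ gives the ordinary
-- primitive recursive definitions, O = ⊤ those with one oracle.
data Scheme (O : Set) : ℕ → Set where
  zero   : ∀ {n} → Scheme O n
  succ   : Scheme O 1
  proj   : ∀ {n} → Fin n → Scheme O n
  oracle : O → Scheme O 1
  comp   : ∀ {m n} → Scheme O m → Vec (Scheme O n) m → Scheme O n
  rec    : ∀ {n} → Scheme O n → Scheme O (2 + n) → Scheme O (suc n)

module _ {O : Set} (g : O → ℕ → ℕ) where

  eval  : ∀ {n} → Scheme O n → Vec ℕ n → ℕ
  evals : ∀ {m n} → Vec (Scheme O n) m → Vec ℕ n → Vec ℕ m

  eval zero       xs           = 0
  eval succ       (x ∷ [])     = suc x
  eval (proj i)   xs           = lookup xs i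
  eval (oracle o) (x ∷ [])     = g o x
  eval (comp p q) xs           = eval p (evals q xs)
  eval (rec p q)  (zero ∷ xs)  = eval p xs
  eval (rec p q)  (suc m ∷ xs) = eval q (m ∷ eval (rec p q) (m ∷ xs) ∷ xs)

  evals []       xs = []
  evals (p ∷ ps) xs = eval p xs ∷ evals ps xs

PrimitiveRecursive : ∀ {n} → (Vec ℕ n → ℕ) → Set
PrimitiveRecursive {n} f = ∃[ p ] ∀ (xs : Vec ℕ n) → eval ⊥-elim p xs ≡ f xs

infix 4 _≤PR_ _≡PR_

_≤PR_ : (f g : ℕ → ℕ) → Set
f ≤PR g = Σ (Scheme ⊤ 1) λ Ψ → ∀ x → eval (const g) Ψ (x ∷ []) ≡ f x

_≡PR_ : (f g : ℕ → ℕ) → Set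
f ≡PR g = f ≤PR g × g ≤PR f

------------------------------------------------------------------------
-- Partial recursive functions

data Program : ℕ → Set where
  zero : ∀ {n} → Program n
  succ : Program 1
  proj : ∀ {n} → Fin n → Program n
  comp : ∀ {m n} → Program m → Vec (Program n) m → Program n
  rec  : ∀ {n} → Program n → Program (2 + n) → Program (suc n)
  mu   : ∀ {n} → Program (suc n) → Program n

infix 4 _[_]↓_

data _[_]↓_ : ∀ {n} → Program n → Vec ℕ n → ℕ → Set where
  zero : ∀ {n} {xs : Vec ℕ n} → zero [ xs ]↓ 0
  succ : ∀ {x} → succ [ x ∷ [] ]↓ suc x
  proj : ∀ {n} {xs : Vec ℕ n} (i : Fin n) → proj i [ xs ]↓ lookup xs i
  comp : ∀ {m n} {p : Program m} {qs : Vec (Program n) m} {xs ys z} →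
         Pointwise (λ q y → q [ xs ]↓ y) qs ys → p [ ys ]↓ z →
         comp p qs [ xs ]↓ z
  rec₀ : ∀ {n} {p : Program n} {q xs y} →
         p [ xs ]↓ y → rec p q [ 0 ∷ xs ]↓ y
  rec₊ : ∀ {n} {p : Program n} {q m xs y z} →
         rec p q [ m ∷ xs ]↓ y → q [ m ∷ y ∷ xs ]↓ z →
         rec p q [ suc m ∷ xs ]↓ z
  mu   : ∀ {n} {p : Program (suc n)} {xs k} →
         (∀ {m} → m < k → ∃[ y ] p [ m ∷ xs ]↓ suc y) →
         p [ k ∷ xs ]↓ 0 → mu p [ xs ]↓ k

Computable : ∀ {n} → (Vec ℕ n → ℕ) → Set
Computable {n} f = ∃[ p ] ∀ (xs : Vec ℕ n) → p [ xs ]↓ f xs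

------------------------------------------------------------------------
-- Coding of tuples

triangle : ℕ → ℕ
triangle zero    = 0
triangle (suc n) = suc n + triangle n

-- Cantor's bijection ℕ × ℕ → ℕ.
pair : ℕ → ℕ → ℕ
pair x y = triangle (x + y) + y

⟪_⟫ : ∀ {n} → Vec ℕ n → ℕ
⟪ [] ⟫     = 0
⟪ x ∷ xs ⟫ = pair x ⟪ xs ⟫

------------------------------------------------------------------------
-- Languages and structures with domain ω

data Size : Set where
  finite   : ℕ → Size
  infinite : Size

Symbol : Size → Set
Symbol (finite n) = Fin n
Symbol infinite   = ℕ

index : ∀ {s} → Symbol s → ℕ
index {finite n} = toℕ
index {infinite} = id

-- A sequence of functions of varying arities has the property P
-- uniformly if a single function with the property P yields, from the
-- index i and the code of a tuple, the value of the i-th function.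
Uniformly : ((Vec ℕ 2 → ℕ) → Set) → ∀ {s} {arity : Symbol s → ℕ} →
            (∀ i → Vec ℕ (arity i) → ℕ) → Set
Uniformly P f =
  ∃[ F ] P F × (∀ i xs → F (index i ∷ ⟪ xs ⟫ ∷ []) ≡ f i xs)

PrimitiveRecursiveArity : ∀ {s} → (Symbol s → ℕ) → Set
PrimitiveRecursiveArity arity =
  ∃[ a ] PrimitiveRecursive (a ∘ head {n = 0}) × (∀ i → a (index i) ≡ arity i)

record Language : Set where
  field
    opSize   : Size
    relSize  : Size
    opArity  : Symbol opSize → ℕ
    relArity : Symbol relSize → ℕ
    opArity-pr  : PrimitiveRecursiveArity opArity
    relArity-pr : PrimitiveRecursiveArity relArity

open Language public

-- Only structures with decidable relations are considered, so relations
-- are Boolean-valued.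
record Structure (L : Language) : Set where
  field
    op  : ∀ i → Vec ℕ (opArity L i) → ℕ
    rel : ∀ i → Vec ℕ (relArity L i) → Bool

  χ : ∀ i → Vec ℕ (relArity L i) → ℕ
  χ i xs = if rel i xs then 1 else 0

open Structure public

module _ {L : Language} where

  PunctualStructure : Structure L → Set
  PunctualStructure A =
    Uniformly PrimitiveRecursive (op A) × Uniformly PrimitiveRecursive (χ A)

  ComputableStructure : Structure L → Set
  ComputableStructure A =
    Uniformly Computable (op A) × Uniformly Computable (χ A)

  record IsIsomorphism (A B : Structure L) (f : ℕ ↔ ℕ) : Set where
    field
      preserves-op  : ∀ i xs → to f (op A i xs) ≡ op B i (map (to f) xs)
      preserves-rel : ∀ i xs → rel A i xs ≡ rel B i (map (to f) xs)

  infix 4 _≅_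

  _≅_ : Structure L → Structure L → Set
  A ≅ B = ∃[ f ] IsIsomorphism A B f

  ----------------------------------------------------------------------
  -- Categoricity

  ComputablyCategorical : Structure L → Set
  ComputablyCategorical A =
    ∀ B C → ComputableStructure B → ComputableStructure C → B ≅ A → C ≅ A →
    ∃[ f ] IsIsomorphism B C f × Computable (to f ∘ head {n = 0})

  PunctuallyIsomorphic : Structure L → Structure L → Set
  PunctuallyIsomorphic A B =
    ∃[ f ] IsIsomorphism A B f
         × PrimitiveRecursive (to f ∘ head {n = 0})
         × PrimitiveRecursive (from f ∘ head {n = 0})

  PunctuallyCategorical : Structure L → Set
  PunctuallyCategorical A =
    ∀ B → PunctualStructure B → B ≅ A → PunctuallyIsomorphic B A

------------------------------------------------------------------------
-- PR-degrees

module _ {O O′ : Set} (Φ : O → Scheme O′ 1) where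

  substitute  : ∀ {n} → Scheme O n → Scheme O′ n
  substitutes : ∀ {m n} → Vec (Scheme O n) m → Vec (Scheme O′ n) m

  substitute zero       = zero
  substitute succ       = succ
  substitute (proj i)   = proj i
  substitute (oracle o) = Φ o
  substitute (comp p q) = comp (substitute p) (substitutes q)
  substitute (rec p q)  = rec (substitute p) (substitute q)

  substitutes []       = []
  substitutes (p ∷ ps) = substitute p ∷ substitutes ps

  module _ {g : O → ℕ → ℕ} {h : O′ → ℕ → ℕ}
           (Φ≡g : ∀ o x → eval h (Φ o) (x ∷ []) ≡ g o x) where

    eval-substitute : ∀ {n} (p : Scheme O n) xs →
      eval h (substitute p) xs ≡ eval g p xs
    evals-substitutes : ∀ {m n} (ps : Vec (Scheme O n) m) xs →
      evals h (substitutes ps) xs ≡ evals g ps xs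

    eval-substitute zero       xs           = refl
    eval-substitute succ       (x ∷ [])     = refl
    eval-substitute (proj i)   xs           = refl
    eval-substitute (oracle o) (x ∷ [])     = Φ≡g o x
    eval-substitute (comp p q) xs           =
      trans (cong (eval h (substitute p)) (evals-substitutes q xs))
            (eval-substitute p (evals g q xs))
    eval-substitute (rec p q)  (zero ∷ xs)  = eval-substitute p xs
    eval-substitute (rec p q)  (suc m ∷ xs) =
      trans (cong (λ y → eval h (substitute q) (m ∷ y ∷ xs))
                  (eval-substitute (rec p q) (m ∷ xs)))
            (eval-substitute q (m ∷ eval g (rec p q) (m ∷ xs) ∷ xs))

    evals-substitutes []       xs = refl
    evals-substitutes (p ∷ ps) xs =
      cong₂ _∷_ (eval-substitute p xs) (evals-substitutes ps xs)

≤PR-refl : ∀ {f} → f ≤PR f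
≤PR-refl = oracle tt , λ x → refl

≤PR-trans : ∀ {f g h} → f ≤PR g → g ≤PR h → f ≤PR h
≤PR-trans (Ψ , Ψ≡f) (Φ , Φ≡g) =
  substitute (const Φ) Ψ ,
  λ x → trans (eval-substitute (const Φ) (const Φ≡g) Ψ (x ∷ [])) (Ψ≡f x)

-- A PR-degree is represented by any of its members; a set of PR-degrees
-- is a predicate on functions that respects _≡PR_.
PRDegrees : Setoid 0ℓ 0ℓ
PRDegrees = record
  { Carrier       = ℕ → ℕ
  ; _≈_           = _≡PR_
  ; isEquivalence = record
    { refl  = ≤PR-refl , ≤PR-refl
    ; sym   = λ (f≤g , g≤f) → g≤f , f≤g
    ; trans = λ (f≤g , g≤f) (g≤h , h≤g) → ≤PR-trans f≤g g≤h , ≤PR-trans h≤g g≤f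
    }
  }

PRDegree : Set
PRDegree = Setoid.Carrier PRDegrees

PRCatSpec : ∀ {L} → Structure L → Pred PRDegree 0ℓ
PRCatSpec A d =
  ∀ B → PunctualStructure B → B ≅ A →
  ∃[ f ] IsIsomorphism A B f × to f ≤PR d × from f ≤PR d

ConeΔ⁰₁ : Pred PRDegree 0ℓ
ConeΔ⁰₁ d = ∀ f → Computable (f ∘ head {n = 0}) → f ≤PR d

PRCatSpec-resp : ∀ {L} (A : Structure L) → PRCatSpec A Respects _≡PR_
PRCatSpec-resp A (d≤e , _) spec B B-punctual B≅A
  with spec B B-punctual B≅A
... | f , f-iso , f≤d , f⁻¹≤d =
  f , f-iso , ≤PR-trans f≤d d≤e , ≤PR-trans f⁻¹≤d d≤e

ConeΔ⁰₁-resp : ConeΔ⁰₁ Respects _≡PR_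
ConeΔ⁰₁-resp (d≤e , _) cone f f-computable = ≤PR-trans (cone f f-computable) d≤e

-- Let v(i) be the value on input i of the unary primitive recursive program
-- coded by the first component of i, let δ(i) ≠ v(i) be a diagonal bit, and let D
-- be a strictly increasing function such that program i halts on i within D(i)
-- steps.  The graph of D is primitive recursive, but D is not, since otherwise δ
-- would be.  A is ω with a constant for every number and unary relations
-- Uᵢ = { y : y ≥ D(i) and δ(i) = 1 }.
--
-- As every element is named, isomorphisms between copies of A are unique, and
-- they are found by searching for names.  In a punctual copy B, the program
-- "does Uᵢ hold of the element x coded in i?" occurs for some i = ⟨e,x⟩; if the
-- name of x were at least D(i), then the answer would be δ(i) ≠ v(i).  So the name
-- is below D(⟨e,x⟩), and bounded search makes the isomorphism primitive recursive
-- in D.  The relations cannot distinguish the elements of a block [D(i-1), D(i)),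
-- so rotating each block gives a punctual copy of A, whose isomorphism to A sends
-- the first element of a block to the last and hence computes D.  Finally D is
-- computable, so diagonalizing against the schemes with oracle D gives a
-- computable function that is not primitive recursive in D.
module Submission where

open import Defs
open import Data.Bool.Base using (Bool; true; false; if_then_else_)
open import Data.Empty using (⊥; ⊥-elim)
open import Data.Fin.Base using (Fin; zero; suc)
open import Data.Fin.Patterns using (0F; 1F; 2F)
open import Data.Nat.Base using (ℕ; zero; suc; pred; _+_; _∸_; _≤_; _<_; z≤n; s≤s; >-nonZero)
open import Data.Nat.Induction using (<-rec)
open import Data.Nat.Properties
open import Data.Product using (Σ; ∃; ∃-syntax; _×_; _,_; proj₁; proj₂)
open import Data.Sum.Base using (_⊎_; inj₁; inj₂)
open import Data.Unit.Base using (⊤; tt)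
open import Data.Vec.Properties using (map-id; map-∘; map-cong)
open import Data.Vec.Base using (Vec; []; _∷_; lookup; head; map)
open import Data.Vec.Relation.Binary.Pointwise.Inductive using (Pointwise; []; _∷_)
open import Function.Base using (_∘_; const; id)
open import Function.Bundles using (Inverse; mk↔ₛ′)
open import Function.Properties.Inverse using (↔-sym; ↔-trans)
open import Relation.Binary.PropositionalEquality
  using (_≡_; refl; sym; trans; cong; cong₂; subst; module ≡-Reasoning)
open import Relation.Nullary using (¬_; yes; no; contradiction)
open import Relation.Unary using (_⊈_)

open Inverse using (to; from; strictlyInverseˡ; strictlyInverseʳ)

private
  variable
    n : ℕ
    f : ℕ → ℕ
    h : ℕ → ℕ → ℕ
    F F₁ F₂ F₃ : Vec ℕ n → ℕ

-- Primitive recursive functions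

PR₁ : (ℕ → ℕ) → Set
PR₁ f = ∃[ p ] ∀ x → eval ⊥-elim p (x ∷ []) ≡ f x

PR₂ : (ℕ → ℕ → ℕ) → Set
PR₂ h = ∃[ p ] ∀ x y → eval ⊥-elim p (x ∷ y ∷ []) ≡ h x y

curry₁ : PrimitiveRecursive F → PR₁ (λ x → F (x ∷ []))
curry₁ (p , p≡) = p , λ x → p≡ (x ∷ [])

curry₂ : PrimitiveRecursive F → PR₂ (λ x y → F (x ∷ y ∷ []))
curry₂ (p , p≡) = p , λ x y → p≡ (x ∷ y ∷ [])

var : (i : Fin n) → PrimitiveRecursive (λ xs → lookup xs i)
var i = proj i , λ xs → refl

app₁ : PR₁ f → PrimitiveRecursive {n} F → PrimitiveRecursive (λ xs → f (F xs))
app₁ {f = f} (p , p≡) (q , q≡) =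
  comp p (q ∷ []) , λ xs → trans (p≡ _) (cong f (q≡ xs))

app₂ : PR₂ h → PrimitiveRecursive {n} F₁ → PrimitiveRecursive F₂ →
       PrimitiveRecursive (λ xs → h (F₁ xs) (F₂ xs))
app₂ {h = h} (p , p≡) (q , q≡) (r , r≡) =
  comp p (q ∷ r ∷ []) , λ xs → trans (p≡ _ _) (cong₂ h (q≡ xs) (r≡ xs))

suc-pr : PR₁ suc
suc-pr = succ , λ x → refl

lit : ∀ k → PrimitiveRecursive {n} (const k)
lit zero    = zero , λ xs → refl
lit (suc k) = app₁ suc-pr (lit k)

primrec₁ : ∀ {k} → f 0 ≡ k → PR₂ h → (∀ n → f (suc n) ≡ h n (f n)) → PR₁ f
primrec₁ {f = f} {h = h} {k = k} f0 (q , q≡) fsuc = rec (proj₁ (lit k)) q , correct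
  where
  correct : ∀ n → eval ⊥-elim (rec (proj₁ (lit k)) q) (n ∷ []) ≡ f n
  correct zero    = trans (proj₂ (lit k) []) (sym f0)
  correct (suc n) =
    trans (q≡ n _) (trans (cong (h n) (correct n)) (sym (fsuc n)))

primrec₂ : PR₁ f → (∀ x → h 0 x ≡ f x) → PrimitiveRecursive F →
           (∀ n x → h (suc n) x ≡ F (n ∷ h n x ∷ x ∷ [])) → PR₂ h
primrec₂ {h = h} {F = F} (p , p≡) h0 (q , q≡) hsuc = rec p q , correct
  where
  correct : ∀ n x → eval ⊥-elim (rec p q) (n ∷ x ∷ []) ≡ h n x
  correct zero    x = trans (p≡ x) (sym (h0 x))
  correct (suc n) x = trans (q≡ _)
    (trans (cong (λ y → F (n ∷ y ∷ x ∷ [])) (correct n x)) (sym (hsuc n x)))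

flip-pr : PR₂ h → PR₂ (λ x y → h y x)
flip-pr h-pr = curry₂ (app₂ h-pr (var 1F) (var 0F))

pred-pr : PR₁ pred
pred-pr = primrec₁ refl (curry₂ (var 0F)) (λ n → refl)

+-pr : PR₂ _+_
+-pr = primrec₂ (curry₁ (var 0F)) (λ x → refl) (app₁ suc-pr (var 1F)) (λ n x → refl)

∸-pr : PR₂ _∸_
∸-pr = flip-pr (primrec₂ {h = λ n m → m ∸ n} (curry₁ (var 0F)) (λ x → refl)
                 (app₁ pred-pr (var 1F)) (λ n m → sym (pred[m∸n]≡m∸[1+n] m n)))

ifz : ℕ → ℕ → ℕ → ℕ
ifz zero    x y = x
ifz (suc _) x y = y

ifz-0 : ∀ {k x y} → k ≡ 0 → ifz k x y ≡ x
ifz-0 refl = refl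

ifz-suc : ∀ {k m x y} → k ≡ suc m → ifz k x y ≡ y
ifz-suc refl = refl

ifz-pr : PrimitiveRecursive {n} F₁ → PrimitiveRecursive F₂ → PrimitiveRecursive F₃ →
         PrimitiveRecursive (λ xs → ifz (F₁ xs) (F₂ xs) (F₃ xs))
ifz-pr {F₁ = F₁} {F₂ = F₂} {F₃ = F₃} (p , p≡) (q , q≡) (r , r≡) =
  comp branch (p ∷ q ∷ r ∷ []) , correct
  where
  branch : Scheme ⊥ 3
  branch = rec (proj 0F) (proj (suc 2F))

  branch≡ : ∀ k x y → eval ⊥-elim branch (k ∷ x ∷ y ∷ []) ≡ ifz k x y
  branch≡ zero    x y = refl
  branch≡ (suc k) x y = refl

  correct : ∀ xs → _ ≡ ifz (F₁ xs) (F₂ xs) (F₃ xs)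
  correct xs rewrite sym (p≡ xs) | sym (q≡ xs) | sym (r≡ xs) = branch≡ (eval ⊥-elim p xs) _ _

distance : ℕ → ℕ → ℕ
distance x y = (x ∸ y) + (y ∸ x)

distance-pr : PR₂ distance
distance-pr = curry₂ (app₂ +-pr (app₂ ∸-pr (var 0F) (var 1F)) (app₂ ∸-pr (var 1F) (var 0F)))

distance-refl : ∀ x → distance x x ≡ 0
distance-refl x rewrite n∸n≡0 x = refl

distance≡0⇒≡ : ∀ {x y} → distance x y ≡ 0 → x ≡ y
distance≡0⇒≡ {x} {y} eq =
  ≤-antisym (m∸n≡0⇒m≤n (m+n≡0⇒m≡0 (x ∸ y) eq)) (m∸n≡0⇒m≤n (m+n≡0⇒n≡0 (x ∸ y) eq))

-- Inverting the Cantor pairing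

-- root c is the number of the diagonal on which c lies.
root : ℕ → ℕ
root zero    = 0
root (suc c) = ifz (triangle (suc (root c)) ∸ suc c) (suc (root c)) (root c)

triangle-pr : PR₁ triangle
triangle-pr = primrec₁ refl (curry₂ (app₂ +-pr (app₁ suc-pr (var 0F)) (var 1F))) (λ n → refl)

root-pr : PR₁ root
root-pr = primrec₁ refl
  (curry₂ (ifz-pr (app₂ ∸-pr (app₁ triangle-pr (app₁ suc-pr (var 1F))) (app₁ suc-pr (var 0F)))
                  (app₁ suc-pr (var 1F)) (var 1F)))
  (λ n → refl)

root-triangle : ∀ m y → y ≤ m → root (triangle m + y) ≡ m
root-triangle zero    zero    y≤m = refl
root-triangle (suc m) zero    y≤m
  rewrite +-identityʳ (m + triangle m) | +-comm m (triangle m)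
        | root-triangle m m ≤-refl | +-comm m (triangle m) =
  ifz-0 (n∸n≡0 (triangle m + m))
root-triangle m       (suc y) y<m
  rewrite +-suc (triangle m) y | root-triangle m y (<⇒≤ y<m)
        | +-comm m (triangle m) | [m+n]∸[m+o]≡n∸o (triangle m) m y =
  ifz-suc {m = pred (m ∸ y)} (sym (suc-pred (m ∸ y) {{>-nonZero (m<n⇒0<n∸m y<m)}}))

root-pair : ∀ x y → root (pair x y) ≡ x + y
root-pair x y = root-triangle (x + y) y (m≤n+m y x)

root≤ : ∀ c → root c ≤ c
root≤ zero    = z≤n
root≤ (suc c) with triangle (suc (root c)) ∸ suc c
... | zero  = s≤s (root≤ c)
... | suc _ = m≤n⇒m≤1+n (root≤ c)

-- Opaque, since unfolding pair at the literal tags below is expensive.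
opaque
  ⟨_,_⟩ : ℕ → ℕ → ℕ
  ⟨ x , y ⟩ = pair x y

  ⟨,⟩≡pair : ∀ x y → ⟨ x , y ⟩ ≡ pair x y
  ⟨,⟩≡pair x y = refl

  π₁ π₂ : ℕ → ℕ
  π₂ c = c ∸ triangle (root c)
  π₁ c = root c ∸ π₂ c

  pair-pr : PR₂ ⟨_,_⟩
  pair-pr = curry₂ (app₂ +-pr (app₁ triangle-pr (app₂ +-pr (var 0F) (var 1F))) (var 1F))

  π₂-pr : PR₁ π₂
  π₂-pr = curry₁ (app₂ ∸-pr (var 0F) (app₁ triangle-pr (app₁ root-pr (var 0F))))

  π₁-pr : PR₁ π₁
  π₁-pr = curry₁ (app₂ ∸-pr (app₁ root-pr (var 0F)) (app₁ π₂-pr (var 0F)))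

  π₂-pair : ∀ x y → π₂ ⟨ x , y ⟩ ≡ y
  π₂-pair x y rewrite root-pair x y = m+n∸m≡n (triangle (x + y)) y

  π₁-pair : ∀ x y → π₁ ⟨ x , y ⟩ ≡ x
  π₁-pair x y rewrite π₂-pair x y | root-pair x y = m+n∸n≡m x y

  π₁≤ : ∀ c → π₁ c ≤ c
  π₁≤ c = ≤-trans (m∸n≤m (root c) (π₂ c)) (root≤ c)

  π₂≤ : ∀ c → π₂ c ≤ c
  π₂≤ c = m∸n≤m c (triangle (root c))

  0<π₁⇒π₂< : ∀ c → 0 < π₁ c → π₂ c < c
  0<π₁⇒π₂< c 0<π₁ with root c in eq
  ... | zero  = contradiction 0<π₁ (≤⇒≯ (m∸n≤m 0 (c ∸ 0)))
  ... | suc r with c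
  ...   | suc c′ = s≤s (m∸n≤m c′ (r + triangle r))

-- Universal evaluation

-- A configuration pairs a stack of instructions with the current value.  The
-- stack is 0 or push c K, and every number c is an instruction: its tag is
-- π₁ c and its two arguments are the components of π₂ c.
instr : ℕ → ℕ → ℕ → ℕ
instr t a b = ⟨ t , ⟨ a , b ⟩ ⟩

push : ℕ → ℕ → ℕ
push c K = suc ⟨ c , K ⟩

flip : ℕ → ℕ
flip v = ifz v 1 0

flip-≢ : ∀ v → ¬ v ≡ flip v
flip-≢ zero    ()
flip-≢ (suc _) ()

-- The oracle g enters only through a test for g x ≤ y, which lets the machine
-- find g x by trying y = 0, 1, ….
module Machine (g : ℕ → ℕ) (test : ℕ → ℕ → ℕ) (test-pr : PR₂ test)
               (test-sound : ∀ {x y} → test x y ≡ 0 → g x ≤ y)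
               (test-complete : ∀ {x y} → g x ≤ y → test x y ≡ 0) where

  -- Tags: 0 zero, 1 successor, 2 and 3 projections, 4 ⟨a,b⟩, 7 b then a,
  -- 8 primitive recursion from a and b, otherwise oracle search.  The frames 5,
  -- 6 and 9 hold what 4 and 8 need after the evaluation of a first component.
  exec : (t a b v K : ℕ) → ℕ
  exec t a b v K =
    ifz t ⟨ K , 0 ⟩ (
    ifz (t ∸ 1) ⟨ K , suc (π₁ v) ⟩ (
    ifz (t ∸ 2) ⟨ K , π₁ v ⟩ (
    ifz (t ∸ 3) ⟨ K , π₂ v ⟩ (
    ifz (t ∸ 4) ⟨ push a (push (instr 5 b v) K) , v ⟩ (
    ifz (t ∸ 5) ⟨ push a (push (instr 6 v 0) K) , b ⟩ (
    ifz (t ∸ 6) ⟨ K , ⟨ a , v ⟩ ⟩ (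
    ifz (t ∸ 7) ⟨ push b (push a K) , v ⟩ (
    ifz (t ∸ 8) (ifz (π₁ v) ⟨ push a K , π₂ v ⟩
      ⟨ push (instr 8 a b) (push (instr 9 (pred (π₁ v)) (π₂ v)) (push b K))
      , ⟨ pred (π₁ v) , π₂ v ⟩ ⟩) (
    ifz (t ∸ 9) ⟨ K , ⟨ a , ⟨ v , b ⟩ ⟩ ⟩ (
    ifz (test (π₁ v) (π₂ v)) ⟨ K , π₂ v ⟩
      ⟨ push (instr 10 0 0) K , ⟨ π₁ v , suc (π₂ v) ⟩ ⟩))))))))))

  perform : (c v K : ℕ) → ℕ
  perform c v K = exec (π₁ c) (π₁ (π₂ c)) (π₂ (π₂ c)) v K

  stepAt : (w K v : ℕ) → ℕ
  stepAt w K v = ifz K w (perform (π₁ (pred K)) v (π₂ (pred K)))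

  step : ℕ → ℕ
  step w = stepAt w (π₁ w) (π₂ w)

  step-pr : PR₁ step
  step-pr = curry₁ (ifz-pr K′ w (
    ifz-pr t (pairs K (lit 0)) (
    ifz-pr (t- 1) (pairs K (app₁ suc-pr v₁)) (
    ifz-pr (t- 2) (pairs K v₁) (
    ifz-pr (t- 3) (pairs K v₂) (
    ifz-pr (t- 4) (pairs (pushes a (pushes (instrs 5 b v) K)) v) (
    ifz-pr (t- 5) (pairs (pushes a (pushes (instrs 6 v (lit 0)) K)) b) (
    ifz-pr (t- 6) (pairs K (pairs a v)) (
    ifz-pr (t- 7) (pairs (pushes b (pushes a K)) v) (
    ifz-pr (t- 8) (ifz-pr v₁ (pairs (pushes a K) v₂)
      (pairs (pushes (instrs 8 a b) (pushes (instrs 9 (app₁ pred-pr v₁) v₂) (pushes b K)))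
             (pairs (app₁ pred-pr v₁) v₂))) (
    ifz-pr (t- 9) (pairs K (pairs a (pairs v b))) (
    ifz-pr (app₂ test-pr v₁ v₂) (pairs K v₂)
      (pairs (pushes (instrs 10 (lit 0) (lit 0)) K) (pairs v₁ (app₁ suc-pr v₂)))))))))))))))
    where
    pairs : PrimitiveRecursive {1} F₁ → PrimitiveRecursive F₂ →
            PrimitiveRecursive (λ xs → ⟨ F₁ xs , F₂ xs ⟩)
    pairs = app₂ pair-pr

    pushes : PrimitiveRecursive {1} F₁ → PrimitiveRecursive F₂ →
             PrimitiveRecursive (λ xs → push (F₁ xs) (F₂ xs))
    pushes c K = app₁ suc-pr (pairs c K)

    instrs : ∀ t → PrimitiveRecursive {1} F₁ → PrimitiveRecursive F₂ →
             PrimitiveRecursive (λ xs → instr t (F₁ xs) (F₂ xs))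
    instrs t a b = pairs (lit t) (pairs a b)

    w   = var {1} 0F
    K′  = app₁ π₁-pr w
    v   = app₁ π₂-pr w
    v₁  = app₁ π₁-pr v
    v₂  = app₁ π₂-pr v
    K   = app₁ π₂-pr (app₁ pred-pr K′)
    c   = app₁ π₁-pr (app₁ pred-pr K′)
    t   = app₁ π₁-pr c
    t-_ = λ k → app₂ ∸-pr t (lit k)
    a   = app₁ π₁-pr (app₁ π₂-pr c)
    b   = app₁ π₂-pr (app₁ π₂-pr c)

  step-push : ∀ c v K → step ⟨ push c K , v ⟩ ≡ perform c v K
  step-push c v K = trans
    (cong₂ (stepAt ⟨ push c K , v ⟩) (π₁-pair (push c K) v) (π₂-pair (push c K) v))
    (cong₂ (λ c K → perform c v K) (π₁-pair c K) (π₂-pair c K))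

  step-halted : ∀ w → π₁ w ≡ 0 → step w ≡ w
  step-halted w = ifz-0

  run : ℕ → ℕ → ℕ
  run zero    w = w
  run (suc s) w = step (run s w)

  run-+ : ∀ r s w → run (r + s) w ≡ run r (run s w)
  run-+ zero    s w = refl
  run-+ (suc r) s w = cong step (run-+ r s w)

  run-pr : PR₂ run
  run-pr = primrec₂ (curry₁ (var 0F)) (λ w → refl) (app₁ step-pr (var 1F)) (λ s w → refl)

  infix  4 _⇒_
  infixr 2 _⨾_

  _⇒_ : ℕ → ℕ → Set
  w ⇒ w′ = ∃[ s ] run s w ≡ w′

  _⨾_ : ∀ {w w′ w″} → w ⇒ w′ → w′ ⇒ w″ → w ⇒ w″
  (s , refl) ⨾ (r , refl) = r + s , run-+ r s _

  done : ∀ {w} → w ⇒ w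
  done = 0 , refl

  retarget : ∀ {w K y z} → y ≡ z → w ⇒ ⟨ K , y ⟩ → w ⇒ ⟨ K , z ⟩
  retarget refl r = r

  Returns : (c x y : ℕ) → Set
  Returns c x y = ∀ K → ⟨ push c K , x ⟩ ⇒ ⟨ K , y ⟩

  ExecReturns : (t a b x y : ℕ) → Set
  ExecReturns t a b x y = ∀ K → exec t a b x K ⇒ ⟨ K , y ⟩

  returns : ∀ c {x y} → ExecReturns (π₁ c) (π₁ (π₂ c)) (π₂ (π₂ c)) x y → Returns c x y
  returns c r K = (1 , step-push c _ K) ⨾ r K

  instr-returns : ∀ t a b {x y} → ExecReturns t a b x y → Returns (instr t a b) x y
  instr-returns t a b {x} r = returns (instr t a b) λ K →
    subst (_⇒ _) (sym (decode K)) (r K)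
    where
    decode : ∀ K → perform (instr t a b) x K ≡ exec t a b x K
    decode K = trans
      (cong₂ (λ t c → exec t (π₁ c) (π₂ c) x K) (π₁-pair t ⟨ a , b ⟩) (π₂-pair t ⟨ a , b ⟩))
      (cong₂ (λ a b → exec t a b x K) (π₁-pair a b) (π₂-pair a b))

  frame-returns : ∀ {a x y z} → Returns a x z → ExecReturns 5 a x y ⟨ y , z ⟩
  frame-returns {y = y} r K = r _ ⨾ instr-returns 6 y 0 (λ K → done) K

  pair-returns : ∀ {a b x y z} → Returns a x y → Returns b x z → ExecReturns 4 a b x ⟨ y , z ⟩
  pair-returns {b = b} {x} r s K = r _ ⨾ instr-returns 5 b x (frame-returns s) K

  comp-returns : ∀ {a b x y z} → Returns b x y → Returns a y z → ExecReturns 7 a b x z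
  comp-returns r s K = r _ ⨾ s K

  rec-zero-returns : ∀ {a b x y} → π₁ x ≡ 0 → Returns a (π₂ x) y → ExecReturns 8 a b x y
  rec-zero-returns x₁ r K = subst (_⇒ _) (sym (ifz-0 x₁)) (r K)

  rec-suc-returns : ∀ {a b x y z m} → π₁ x ≡ suc m → Returns (instr 8 a b) ⟨ m , π₂ x ⟩ y →
                    Returns b ⟨ m , ⟨ y , π₂ x ⟩ ⟩ z → ExecReturns 8 a b x z
  rec-suc-returns {a} {b} {x} {m = m} x₁ r s K rewrite x₁ =
    r _ ⨾ instr-returns 9 m (π₂ x) (λ K → done) _ ⨾ s K

  search-returns : ∀ d t {a b} x → g (π₁ x) ∸ π₂ x ≡ d → ExecReturns (10 + t) a b x (π₂ x + d)
  search-returns zero t x d≡ K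
    rewrite test-complete {π₁ x} {π₂ x} (m∸n≡0⇒m≤n d≡) | +-identityʳ (π₂ x) = done
  search-returns (suc d) t x d≡ K with test (π₁ x) (π₂ x) in eq
  ... | zero  = contradiction (trans (sym d≡) (m≤n⇒m∸n≡0 (test-sound eq))) λ ()
  ... | suc _ = retarget result
                  (instr-returns 10 0 0 (search-returns d 0 {0} {0} x′ d′≡) K)
    where
    x′ = ⟨ π₁ x , suc (π₂ x) ⟩

    result : π₂ x′ + d ≡ π₂ x + suc d
    result rewrite π₂-pair (π₁ x) (suc (π₂ x)) = sym (+-suc (π₂ x) d)

    d′≡ : g (π₁ x′) ∸ π₂ x′ ≡ d
    d′≡ rewrite π₁-pair (π₁ x) (suc (π₂ x)) | π₂-pair (π₁ x) (suc (π₂ x)) =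
      trans (sym (pred[m∸n]≡m∸[1+n] (g (π₁ x)) (π₂ x))) (cong pred d≡)

  Terminates : ℕ → Set
  Terminates c = ∀ x → ∃[ y ] Returns c x y

  exec-terminates : ∀ t a b → (0 < t → Terminates a) → (0 < t → Terminates b) →
                    ∀ x → ∃[ y ] ExecReturns t a b x y
  exec-terminates 0 a b _ _ x = _ , λ K → done
  exec-terminates 1 a b _ _ x = _ , λ K → done
  exec-terminates 2 a b _ _ x = _ , λ K → done
  exec-terminates 3 a b _ _ x = _ , λ K → done
  exec-terminates 4 a b ta tb x =
    _ , pair-returns (proj₂ (ta (s≤s z≤n) x)) (proj₂ (tb (s≤s z≤n) x))
  exec-terminates 5 a b ta _ x = _ , frame-returns (proj₂ (ta (s≤s z≤n) b))
  exec-terminates 6 a b _ _ x = ⟨ a , x ⟩ , λ K → done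
  exec-terminates 7 a b ta tb x =
    _ , comp-returns (proj₂ (tb (s≤s z≤n) x)) (proj₂ (ta (s≤s z≤n) _))
  exec-terminates 8 a b ta tb x = recursion (π₁ x) x refl
    where
    recursion : ∀ m x → π₁ x ≡ m → ∃[ y ] ExecReturns 8 a b x y
    recursion zero    x x₁ = _ , rec-zero-returns x₁ (proj₂ (ta (s≤s z≤n) (π₂ x)))
    recursion (suc m) x x₁ =
      _ , rec-suc-returns x₁
            (instr-returns 8 a b (proj₂ (recursion m ⟨ m , π₂ x ⟩ (π₁-pair m (π₂ x)))))
            (proj₂ (tb (s≤s z≤n) _))
  exec-terminates 9 a b _ _ x = ⟨ a , ⟨ x , b ⟩ ⟩ , λ K → done
  exec-terminates (suc (suc (suc (suc (suc (suc (suc (suc (suc (suc t)))))))))) a b _ _ x =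
    _ , search-returns _ t {a} {b} x refl

  terminates : ∀ c → Terminates c
  terminates = <-rec Terminates λ c below x →
    let small = 0<π₁⇒π₂< c
        y , r = exec-terminates (π₁ c) (π₁ (π₂ c)) (π₂ (π₂ c))
                  (λ 0<t → below (≤-<-trans (π₁≤ (π₂ c)) (small 0<t)))
                  (λ 0<t → below (≤-<-trans (π₂≤ (π₂ c)) (small 0<t))) x
    in y , returns c r

  code-proj : Fin n → ℕ
  code-proj zero    = instr 2 0 0
  code-proj (suc i) = instr 7 (code-proj i) (instr 3 0 0)

  code  : Scheme ⊤ n → ℕ
  codes : ∀ {m} → Vec (Scheme ⊤ n) m → ℕ
  code zero       = instr 0 0 0
  code succ       = instr 1 0 0
  code (proj i)   = code-proj i
  code (oracle _) = instr 10 0 0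
  code (comp p q) = instr 7 (code p) (codes q)
  code (rec p q)  = instr 8 (code p) (code q)
  codes []        = instr 0 0 0
  codes (p ∷ ps)  = instr 4 (code p) (codes ps)

  tuple : Vec ℕ n → ℕ
  tuple []       = 0
  tuple (x ∷ xs) = ⟨ x , tuple xs ⟩

  code-proj-returns : (i : Fin n) (xs : Vec ℕ n) →
                      Returns (code-proj i) (tuple xs) (lookup xs i)
  code-proj-returns zero (x ∷ xs) =
    instr-returns 2 0 0 λ K → 0 , cong ⟨ K ,_⟩ (π₁-pair x (tuple xs))
  code-proj-returns (suc i) (x ∷ xs) = instr-returns 7 _ _ (comp-returns
    (instr-returns 3 0 0 λ K → 0 , cong ⟨ K ,_⟩ (π₂-pair x (tuple xs)))
    (code-proj-returns i xs))

  code-returns  : (p : Scheme ⊤ n) (xs : Vec ℕ n) →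
                  Returns (code p) (tuple xs) (eval (const g) p xs)
  codes-returns : ∀ {m} (ps : Vec (Scheme ⊤ n) m) (xs : Vec ℕ n) →
                  Returns (codes ps) (tuple xs) (tuple (evals (const g) ps xs))
  code-returns zero       xs       = instr-returns 0 0 0 λ K → done
  code-returns succ       (x ∷ []) =
    instr-returns 1 0 0 λ K → 0 , cong (λ x → ⟨ K , suc x ⟩) (π₁-pair x 0)
  code-returns (proj i)   xs       = code-proj-returns i xs
  code-returns (oracle _) (x ∷ []) =
    instr-returns 10 0 0 λ K → retarget found (search-returns _ 0 {0} {0} _ refl K)
    where
    found : π₂ ⟨ x , 0 ⟩ + (g (π₁ ⟨ x , 0 ⟩) ∸ π₂ ⟨ x , 0 ⟩) ≡ g x
    found rewrite π₁-pair x 0 | π₂-pair x 0 = refl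
  code-returns (comp p q) xs       = instr-returns 7 _ _
    (comp-returns (codes-returns q xs) (code-returns p (evals (const g) q xs)))
  code-returns (rec p q)  (zero ∷ xs) = instr-returns 8 _ _
    (rec-zero-returns (π₁-pair 0 (tuple xs))
      (subst (λ x → Returns (code p) x _) (sym (π₂-pair 0 (tuple xs))) (code-returns p xs)))
  code-returns (rec p q)  (suc m ∷ xs) = instr-returns 8 _ _
    (rec-suc-returns (π₁-pair (suc m) (tuple xs))
      (subst (λ x → Returns _ ⟨ m , x ⟩ _) tail≡ (code-returns (rec p q) (m ∷ xs)))
      (subst (λ x → Returns (code q) ⟨ m , ⟨ y , x ⟩ ⟩ _) tail≡ (code-returns q (m ∷ y ∷ xs))))
    where
    y = eval (const g) (rec p q) (m ∷ xs)

    tail≡ : tuple xs ≡ π₂ ⟨ suc m , tuple xs ⟩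
    tail≡ = sym (π₂-pair (suc m) (tuple xs))
  codes-returns []       xs = instr-returns 0 0 0 λ K → done
  codes-returns (p ∷ ps) xs =
    instr-returns 4 _ _ (pair-returns (code-returns p xs) (codes-returns ps xs))

  initial : ℕ → ℕ
  initial i = ⟨ push (π₁ i) 0 , ⟨ i , 0 ⟩ ⟩

  output : ℕ → ℕ
  output w = ifz (π₁ w) (suc (π₂ w)) 0

  -- H i s is suc v if the program with code π₁ i, run on the input i, has
  -- halted with value v after s steps, and 0 if it is still running.
  opaque
    H : ℕ → ℕ → ℕ
    H i s = output (run s (initial i))

    H-pr : PR₂ H
    H-pr = curry₂ (app₁ output-pr (app₂ run-pr (var 1F) (app₁ initial-pr (var 0F))))
      where
      output-pr : PR₁ output
      output-pr = curry₁ (ifz-pr (app₁ π₁-pr (var 0F)) (app₁ suc-pr (app₁ π₂-pr (var 0F))) (lit 0))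

      initial-pr : PR₁ initial
      initial-pr = curry₁ (app₂ pair-pr
        (app₁ suc-pr (app₂ pair-pr (app₁ π₁-pr (var 0F)) (lit 0)))
        (app₂ pair-pr (var 0F) (lit 0)))

    returns⇒halts : ∀ i {v} → Returns (π₁ i) ⟨ i , 0 ⟩ v → ∃[ s ] H i s ≡ suc v
    returns⇒halts i {v} r with r 0
    ... | s , eq = s , trans (cong output eq)
      (trans (ifz-0 (π₁-pair 0 v)) (cong suc (π₂-pair 0 v)))

    H-suc : ∀ {i s v} → H i s ≡ suc v → H i (suc s) ≡ suc v
    H-suc {i} {s} eq =
      trans (cong output (step-halted (run s (initial i)) (empty _ _ eq))) eq
      where
      empty : ∀ k x {v} → ifz k x 0 ≡ suc v → k ≡ 0
      empty zero x _ = refl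

  Halts : ℕ → ℕ → Set
  Halts i v = ∃[ s ] H i s ≡ suc v

  halts : ∀ i → ∃[ v ] Halts i v
  halts i with terminates (π₁ i) ⟨ i , 0 ⟩
  ... | v , r = v , returns⇒halts i r

  code-halts : ∀ (p : Scheme ⊤ 1) i → π₁ i ≡ code p → Halts i (eval (const g) p (i ∷ []))
  code-halts p i i₁ = returns⇒halts i
    (subst (λ c → Returns c _ _) (sym i₁) (code-returns p (i ∷ [])))

  H-≤ : ∀ {i s r v} → s ≤ r → H i s ≡ suc v → H i r ≡ suc v
  H-≤ {i} {s} {r} {v} s≤r eq = subst (λ r → H i r ≡ suc v) (m∸n+n≡m s≤r) (go (r ∸ s))
    where
    go : ∀ k → H i (k + s) ≡ suc v
    go zero    = eq
    go (suc k) = H-suc (go k)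

  halts-unique : ∀ {i u v} → Halts i u → Halts i v → u ≡ v
  halts-unique {u = u} (s , Hs) (r , Hr) with ≤-total s r
  ... | inj₁ s≤r = suc-injective (trans (sym (H-≤ s≤r Hs)) Hr)
  ... | inj₂ r≤s = suc-injective (trans (sym Hs) (H-≤ r≤s Hr))

  -- count y is the number of programs found to halt in the first y stages, when
  -- the programs are examined in order and each stage s runs the current one
  -- for s steps.
  count : ℕ → ℕ
  count zero    = 0
  count (suc y) = ifz (H (count y) y) (count y) (suc (count y))

  count-pr : PR₁ count
  count-pr = primrec₁ refl
    (curry₂ (ifz-pr (app₂ H-pr (var 1F) (var 0F)) (var 1F) (app₁ suc-pr (var 1F))))
    (λ n → refl)

  count-suc : ∀ y → (count (suc y) ≡ count y) ⊎ (count (suc y) ≡ suc (count y))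
  count-suc y with H (count y) y
  ... | zero  = inj₁ refl
  ... | suc _ = inj₂ refl

  count-mono : ∀ {y z} → y ≤ z → count y ≤ count z
  count-mono {y} {z} y≤z = subst (λ z → count y ≤ count z) (m∸n+n≡m y≤z) (go (z ∸ y))
    where
    go : ∀ k → count y ≤ count (k + y)
    go zero    = ≤-refl
    go (suc k) with count-suc (k + y)
    ... | inj₁ eq rewrite eq = go k
    ... | inj₂ eq rewrite eq = m≤n⇒m≤1+n (go k)

  <count⇒halted : ∀ {i} y → i < count y → ∃[ v ] H i y ≡ suc v
  <count⇒halted {i} (suc y) i<count with H (count y) y in eq
  ... | zero = let v , Hy = <count⇒halted y i<count in v , H-suc Hy
  ... | suc v with m≤n⇒m<n∨m≡n (≤-pred i<count)
  ...   | inj₁ i<county = let v , Hy = <count⇒halted y i<county in v , H-suc Hy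
  ...   | inj₂ refl     = v , H-suc eq

  LastStage : ℕ → ℕ → Set
  LastStage i y = count y ≡ i × count (suc y) ≡ suc i

  last-stage-after : ∀ n z {i v} → count z ≡ i → H i (n + z) ≡ suc v → ∃ (LastStage i)
  last-stage-after zero z {i} z≡i Hz =
    z , z≡i , trans (ifz-suc (trans (cong (λ i → H i z) z≡i) Hz)) (cong suc z≡i)
  last-stage-after (suc n) z {i} {v} z≡i Hz with count-suc z
  ... | inj₁ stay = last-stage-after n (suc z) (trans stay z≡i)
                      (trans (cong (H i) (+-suc n z)) Hz)
  ... | inj₂ jump = z , z≡i , trans jump (cong suc z≡i)

  last-stage-from : ∀ i z → count z ≡ i → ∃ (LastStage i)
  last-stage-from i z z≡i =
    let v , s , Hs = halts i in last-stage-after s z z≡i (H-≤ (m≤m+n s z) Hs)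

  last-stage : ∀ i → ∃ (LastStage i)
  last-stage zero    = last-stage-from 0 0 refl
  last-stage (suc i) =
    let y , _ , suc-y≡ = last-stage i in last-stage-from (suc i) (suc y) suc-y≡

  opaque
    last : ℕ → ℕ
    last i = proj₁ (last-stage i)

    count-last : ∀ i → count (last i) ≡ i
    count-last i = proj₁ (proj₂ (last-stage i))

    count-suc-last : ∀ i → count (suc (last i)) ≡ suc i
    count-suc-last i = proj₂ (proj₂ (last-stage i))

  last-unique : ∀ {y i} → count y ≡ i → count (suc y) ≡ suc i → last i ≡ y
  last-unique {y} {i} eq eq′ =
    ≤-antisym (before (count-last i) eq′) (before eq (count-suc-last i))
    where
    before : ∀ {x z} → count x ≡ i → count (suc z) ≡ suc i → x ≤ z
    before {x} {z} eq eq′ with x ≤? z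
    ... | yes x≤z = x≤z
    ... | no  x≰z = contradiction (count-mono (≰⇒> x≰z))
                      (subst (λ k → ¬ k ≤ count x) (sym eq′)
                        (subst (λ k → ¬ suc i ≤ k) (sym eq) (<-irrefl refl)))

  D : ℕ → ℕ
  D i = suc (last i)

  D≤⇒<count : ∀ {i y} → D i ≤ y → i < count y
  D≤⇒<count {i} {y} D≤y = subst (_≤ count y) (count-suc-last i) (count-mono D≤y)

  <count⇒D≤ : ∀ {i y} → i < count y → D i ≤ y
  <count⇒D≤ {i} {y} i<count with D i ≤? y
  ... | yes D≤y = D≤y
  ... | no  D≰y = contradiction i<count
    (≤⇒≯ (subst (count y ≤_) (count-last i) (count-mono (≤-pred (≰⇒> D≰y)))))

  testD : ℕ → ℕ → ℕ
  testD i y = suc i ∸ count y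

  testD-pr : PR₂ testD
  testD-pr = curry₂ (app₂ ∸-pr (app₁ suc-pr (var 0F)) (app₁ count-pr (var 1F)))

  testD-sound : ∀ {i y} → testD i y ≡ 0 → D i ≤ y
  testD-sound eq = <count⇒D≤ (m∸n≡0⇒m≤n eq)

  testD-complete : ∀ {i y} → D i ≤ y → testD i y ≡ 0
  testD-complete D≤y = m≤n⇒m∸n≡0 (D≤⇒<count D≤y)

  diagonal : ℕ → ℕ
  diagonal i = flip (pred (H i (D i)))

  halts⇒diagonal : ∀ {i v} → Halts i v → diagonal i ≡ flip v
  halts⇒diagonal {i} h =
    let u , HD = <count⇒halted (D i) (D≤⇒<count ≤-refl)
    in cong flip (trans (cong pred HD) (halts-unique {i} (D i , HD) h))

  diagonal-≰PR : ¬ diagonal ≤PR g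
  diagonal-≰PR (p , p≡) =
    flip-≢ _ (trans (p≡ i) (halts⇒diagonal {i} (code-halts p i (π₁-pair (code p) 0))))
    where
    i = ⟨ code p , 0 ⟩

-- Computable functions

embed  : Scheme ⊥ n → Program n
embeds : ∀ {m} → Vec (Scheme ⊥ n) m → Vec (Program n) m
embed zero       = zero
embed succ       = succ
embed (proj i)   = proj i
embed (comp p q) = comp (embed p) (embeds q)
embed (rec p q)  = rec (embed p) (embed q)
embeds []        = []
embeds (p ∷ ps)  = embed p ∷ embeds ps

embed-↓  : (p : Scheme ⊥ n) (xs : Vec ℕ n) → embed p [ xs ]↓ eval ⊥-elim p xs
embeds-↓ : ∀ {m} (ps : Vec (Scheme ⊥ n) m) (xs : Vec ℕ n) →
           Pointwise (λ p y → p [ xs ]↓ y) (embeds ps) (evals ⊥-elim ps xs)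
embed-↓ zero       xs           = zero
embed-↓ succ       (x ∷ [])     = succ
embed-↓ (proj i)   xs           = proj i
embed-↓ (comp p q) xs           = comp (embeds-↓ q xs) (embed-↓ p _)
embed-↓ (rec p q)  (zero ∷ xs)  = rec₀ (embed-↓ p xs)
embed-↓ (rec p q)  (suc m ∷ xs) = rec₊ (embed-↓ (rec p q) (m ∷ xs)) (embed-↓ q _)
embeds-↓ []        xs = []
embeds-↓ (p ∷ ps)  xs = embed-↓ p xs ∷ embeds-↓ ps xs

pr⇒computable : PrimitiveRecursive {n} F → Computable F
pr⇒computable (p , p≡) = embed p , λ xs → subst (embed p [ xs ]↓_) (p≡ xs) (embed-↓ p xs)

PR₁⇒computable : PR₁ f → Computable {n} F → Computable (λ xs → f (F xs))
PR₁⇒computable {F = F} (p , p≡) (q , q↓) = comp (embed p) (q ∷ []) , λ xs →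
  comp (q↓ xs ∷ []) (subst (embed p [ _ ]↓_) (p≡ (F xs)) (embed-↓ p (F xs ∷ [])))

PR₂⇒computable : PR₂ h → Computable {n} F₁ → Computable F₂ →
                 Computable (λ xs → h (F₁ xs) (F₂ xs))
PR₂⇒computable {F₁ = F₁} {F₂ = F₂} (p , p≡) (q , q↓) (r , r↓) =
  comp (embed p) (q ∷ r ∷ []) , λ xs → comp (q↓ xs ∷ r↓ xs ∷ [])
    (subst (embed p [ _ ]↓_) (p≡ (F₁ xs) (F₂ xs)) (embed-↓ p (F₁ xs ∷ F₂ xs ∷ [])))

comp-computable : {G : Vec ℕ 2 → ℕ} → Computable G → Computable {n} F₁ → Computable F₂ →
                  Computable (λ xs → G (F₁ xs ∷ F₂ xs ∷ []))
comp-computable (p , p↓) (q , q↓) (r , r↓) =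
  comp p (q ∷ r ∷ []) , λ xs → comp (q↓ xs ∷ r↓ xs ∷ []) (p↓ _)

minimization-computable : {G : Vec ℕ (suc n) → ℕ} → Computable G →
  (∀ xs → G (F xs ∷ xs) ≡ 0) → (∀ xs {m} → m < F xs → ¬ G (m ∷ xs) ≡ 0) → Computable F
minimization-computable {F = F} {G} (p , p↓) found least = mu p , λ xs →
  mu (λ {m} m<F → nonzero xs (least xs m<F) refl)
     (subst (p [ F xs ∷ xs ]↓_) (found xs) (p↓ _))
  where
  nonzero : ∀ xs {m y} → ¬ G (m ∷ xs) ≡ 0 → y ≡ G (m ∷ xs) → ∃[ z ] p [ m ∷ xs ]↓ suc z
  nonzero xs {m} {zero}  G≢0 eq = contradiction (sym eq) G≢0
  nonzero xs {m} {suc y} G≢0 eq = y , subst (p [ m ∷ xs ]↓_) (sym eq) (p↓ (m ∷ xs))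

-- Functions reducible to an oracle

lift : Scheme ⊥ n → Scheme ⊤ n
lift = substitute λ ()

eval-lift : ∀ (d : ℕ → ℕ) (p : Scheme ⊥ n) xs → eval (const d) (lift p) xs ≡ eval ⊥-elim p xs
eval-lift d = eval-substitute (λ ()) (λ ())

PR₁⇒≤PR : ∀ {d} → PR₁ f → f ≤PR d
PR₁⇒≤PR {d = d} (p , p≡) = lift p , λ x → trans (eval-lift d p (x ∷ [])) (p≡ x)

-- Isomorphisms

module _ {L : Language} where

  ≅-sym : {A B : Structure L} → A ≅ B → B ≅ A
  ≅-sym {A} {B} (f , f-iso) = ↔-sym f , record
    { preserves-op  = λ i xs → begin
        from f (op B i xs)                           ≡⟨ cong (from f ∘ op B i) (map-to-from xs) ⟨
        from f (op B i (map (to f) (map (from f) xs))) ≡⟨ cong (from f) (preserves-op i _) ⟨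
        from f (to f (op A i (map (from f) xs)))     ≡⟨ strictlyInverseʳ f _ ⟩
        op A i (map (from f) xs)                     ∎
    ; preserves-rel = λ i xs → begin
        rel B i xs                             ≡⟨ cong (rel B i) (map-to-from xs) ⟨
        rel B i (map (to f) (map (from f) xs)) ≡⟨ preserves-rel i _ ⟨
        rel A i (map (from f) xs)              ∎
    }
    where
    open ≡-Reasoning
    open IsIsomorphism f-iso

    map-to-from : (xs : Vec ℕ n) → map (to f) (map (from f) xs) ≡ xs
    map-to-from xs = begin
      map (to f) (map (from f) xs) ≡⟨ map-∘ (to f) (from f) xs ⟨
      map (to f ∘ from f) xs       ≡⟨ map-cong (strictlyInverseˡ f) xs ⟩
      map id xs                    ≡⟨ map-id xs ⟩
      xs                           ∎

  ≅-trans : {A B C : Structure L} → A ≅ B → B ≅ C → A ≅ C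
  ≅-trans {C = C} (f , f-iso) (g , g-iso) = ↔-trans f g , record
    { preserves-op  = λ i xs →
        trans (cong (to g) (F.preserves-op i xs))
              (trans (G.preserves-op i _) (cong (op C i) (sym (map-∘ (to g) (to f) xs))))
    ; preserves-rel = λ i xs →
        trans (F.preserves-rel i xs)
              (trans (G.preserves-rel i _) (cong (rel C i) (sym (map-∘ (to g) (to f) xs))))
    }
    where
    module F = IsIsomorphism f-iso
    module G = IsIsomorphism g-iso

-- The structure

open Machine (const 0) (λ _ _ → 0) (curry₂ (lit 0)) (λ _ → z≤n) (λ _ → refl)

module Relative = Machine D testD testD-pr testD-sound testD-complete

U : ℕ → ℕ → ℕ
U i y = ifz (testD i y) (diagonal i) 0

U-late : ∀ {i y} → D i ≤ y → U i y ≡ diagonal i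
U-late D≤y = ifz-0 (testD-complete D≤y)

U-pr : PR₂ U
U-pr = let p , p≡ = U′-pr in p , λ i y → trans (p≡ i y) (U′≡U i y)
  where
  U′ : ℕ → ℕ → ℕ
  U′ i y = ifz (testD i y) (ifz (pred (H i y)) 1 0) 0

  U′-pr : PR₂ U′
  U′-pr = curry₂ (ifz-pr (app₂ testD-pr (var 0F) (var 1F))
    (ifz-pr (app₁ pred-pr (app₂ H-pr (var 0F) (var 1F))) (lit 1) (lit 0)) (lit 0))

  U′≡U : ∀ i y → U′ i y ≡ U i y
  U′≡U i y with testD i y in eq
  ... | suc _ = refl
  ... | zero  =
    let v , Hy = <count⇒halted y (m∸n≡0⇒m≤n eq)
    in trans (cong (flip ∘ pred) Hy) (sym (halts⇒diagonal {i} (y , Hy)))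

positive : ℕ → Bool
positive zero    = false
positive (suc _) = true

language : Language
language = record
  { opSize      = infinite
  ; relSize     = infinite
  ; opArity     = const 0
  ; relArity    = const 1
  ; opArity-pr  = const 0 , lit 0 , λ i → refl
  ; relArity-pr = const 1 , lit 1 , λ i → refl
  }

named : (ℕ → ℕ) → Structure language
named f = record
  { op  = λ i _ → f i
  ; rel = λ { i (y ∷ []) → positive (U i y) }
  }

χ-named : ∀ f i y → χ (named f) i (y ∷ []) ≡ U i y
χ-named f i y = bit (testD i y) (pred (H i (D i)))
  where
  bit : ∀ k v → (if positive (ifz k (flip v) 0) then 1 else 0) ≡ ifz k (flip v) 0
  bit zero    zero    = refl
  bit zero    (suc _) = refl
  bit (suc _) _       = refl

named-punctual : PR₁ f → PunctualStructure (named f)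
named-punctual {f} f-pr =
  (_ , app₁ f-pr (var 0F) , λ i xs → refl) ,
  (_ , app₂ U-pr (var 0F) (app₁ π₁-pr (var 1F)) , λ { i (y ∷ []) → decode i y })
  where
  decode : ∀ i y → U i (π₁ (pair y 0)) ≡ χ (named f) i (y ∷ [])
  decode i y rewrite sym (⟨,⟩≡pair y 0) | π₁-pair y 0 = sym (χ-named f i y)

A : Structure language
A = named id

constant-name : {B : Structure language} (B≅A : B ≅ A) → ∀ i → op B i [] ≡ from (proj₁ B≅A) i
constant-name {B} (φ , φ-iso) i = trans (sym (strictlyInverseʳ φ (op B i [])))
                                       (cong (from φ) (IsIsomorphism.preserves-op φ-iso i []))

A-computably-categorical : ComputablyCategorical A
A-computably-categorical B C ((F , F-comp , F≡) , _) ((G , G-comp , G≡) , _) B≅A C≅A =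
  proj₁ B≅C , proj₂ B≅C , B≅C-computable
  where
  B≅C = ≅-trans B≅A (≅-sym C≅A)
  φ   = proj₁ B≅A

  F-name : ∀ i → F (i ∷ 0 ∷ []) ≡ from φ i
  F-name i = trans (F≡ i []) (constant-name B≅A i)

  G-name : ∀ i → G (i ∷ 0 ∷ []) ≡ from (proj₁ C≅A) i
  G-name i = trans (G≡ i []) (constant-name C≅A i)

  name-computable : Computable (to φ ∘ head {n = 0})
  name-computable = minimization-computable
    (PR₂⇒computable distance-pr
      (comp-computable F-comp (pr⇒computable (var 0F)) (pr⇒computable (lit 0)))
      (pr⇒computable (var 1F)))
    (λ { (x ∷ []) → trans
      (cong (λ y → distance y x) (trans (F-name (to φ x)) (strictlyInverseʳ φ x)))
      (distance-refl x) })
    (λ { (x ∷ []) {m} m<φx d≡0 → <-irrefl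
      (trans (sym (strictlyInverseˡ φ m))
             (cong (to φ) (trans (sym (F-name m)) (distance≡0⇒≡ d≡0)))) m<φx })

  B≅C-computable : Computable (to (proj₁ B≅C) ∘ head {n = 0})
  B≅C-computable = let p , p↓ = comp-computable G-comp name-computable (pr⇒computable (lit 0))
    in p , λ { (x ∷ []) → subst (p [ x ∷ [] ]↓_) (G-name (to φ x)) (p↓ (x ∷ [])) }

-- The copy obtained by rotating each block of stages on which count is constant

first : ℕ → ℕ
first zero    = 0
first (suc i) = D i

count-first : ∀ i → count (first i) ≡ i
count-first zero    = refl
count-first (suc i) = count-suc-last i

-- jump y is 0 if y is the last stage of its block and 1 otherwise.
jump : ℕ → ℕ
jump y = suc (count y) ∸ count (suc y)

jump-suc : ∀ {y} → count (suc y) ≡ suc (count y) → jump y ≡ 0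
jump-suc {y} eq rewrite eq = n∸n≡0 (count y)

jump-stay : ∀ {y} → count (suc y) ≡ count y → jump y ≡ 1
jump-stay {y} eq rewrite eq = m+n∸n≡m 1 (count y)

jump-pr : PR₁ jump
jump-pr = curry₁ (app₂ ∸-pr (app₁ suc-pr (app₁ count-pr (var 0F)))
                            (app₁ count-pr (app₁ suc-pr (var 0F))))

rotate : ℕ → ℕ
rotate y = ifz (jump y) (first (count y)) (suc y)

rotate⁻¹ : ℕ → ℕ
rotate⁻¹ zero    = last 0
rotate⁻¹ (suc y) = ifz (jump y) (last (suc (count y))) y

rotate-pr : PR₁ rotate
rotate-pr = curry₁ (ifz-pr (app₁ jump-pr (var 0F)) (app₁ start-pr (var 0F)) (app₁ suc-pr (var 0F)))
  where
  start-suc : ∀ y → first (count (suc y)) ≡ ifz (jump y) (suc y) (first (count y))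
  start-suc y with count-suc y
  ... | inj₁ eq = trans (cong first eq) (sym (ifz-suc (jump-stay eq)))
  ... | inj₂ eq = trans (cong first eq)
                    (trans (cong suc (last-unique refl eq)) (sym (ifz-0 (jump-suc eq))))

  start-pr : PR₁ (first ∘ count)
  start-pr = primrec₁ refl
    (curry₂ (ifz-pr (app₁ jump-pr (var 0F)) (app₁ suc-pr (var 0F)) (var 1F))) start-suc

jump-last : ∀ i → jump (last i) ≡ 0
jump-last i = jump-suc (trans (count-suc-last i) (cong suc (sym (count-last i))))

rotate-last : ∀ i → rotate (last i) ≡ first i
rotate-last i = trans (ifz-0 (jump-last i)) (cong first (count-last i))

rotate⁻¹-first : ∀ i → rotate⁻¹ (first i) ≡ last i
rotate⁻¹-first zero    = refl
rotate⁻¹-first (suc i) = trans (ifz-0 (jump-last i)) (cong (last ∘ suc) (count-last i))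

rotate-rotate⁻¹ : ∀ x → rotate (rotate⁻¹ x) ≡ x
rotate-rotate⁻¹ zero    = rotate-last 0
rotate-rotate⁻¹ (suc y) with count-suc y
... | inj₁ eq = trans (cong rotate (ifz-suc (jump-stay eq))) (ifz-suc (jump-stay eq))
... | inj₂ eq = trans (cong rotate (ifz-0 (jump-suc eq)))
                  (trans (rotate-last (suc (count y))) (cong suc (last-unique refl eq)))

rotate⁻¹-rotate : ∀ y → rotate⁻¹ (rotate y) ≡ y
rotate⁻¹-rotate y with count-suc y
... | inj₁ eq = trans (cong rotate⁻¹ (ifz-suc (jump-stay eq))) (ifz-suc (jump-stay eq))
... | inj₂ eq = trans (cong rotate⁻¹ (ifz-0 (jump-suc eq)))
                  (trans (rotate⁻¹-first (count y)) (last-unique refl eq))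

count-rotate : ∀ y → count (rotate y) ≡ count y
count-rotate y with count-suc y
... | inj₁ eq = trans (cong count (ifz-suc (jump-stay eq))) eq
... | inj₂ eq = trans (cong count (ifz-0 (jump-suc eq))) (count-first (count y))

rotated≅A : named rotate ≅ A
rotated≅A = mk↔ₛ′ rotate⁻¹ rotate rotate⁻¹-rotate rotate-rotate⁻¹ , record
  { preserves-op  = λ i xs → rotate⁻¹-rotate i
  ; preserves-rel = λ { i (x ∷ []) →
      cong (λ k → positive (ifz (suc i ∸ k) (diagonal i) 0))
        (trans (cong count (sym (rotate-rotate⁻¹ x))) (count-rotate (rotate⁻¹ x))) }
  }

diagonal-pr : PR₁ D → PR₁ diagonal
diagonal-pr D-pr = curry₁ (ifz-pr
  (app₁ pred-pr (app₂ H-pr (var 0F) (app₁ D-pr (var 0F)))) (lit 1) (lit 0))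

rotate-inverse⇒D-pr : PR₁ f → (∀ i → f (rotate i) ≡ i) → PR₁ D
rotate-inverse⇒D-pr {f} f-pr f-rotate =
  curry₁ (app₁ first-pr (app₁ suc-pr (var 0F)))
  where
  first-pr : PR₁ first
  first-pr = primrec₁ refl (curry₂ (app₁ suc-pr (app₁ f-pr (var 1F))))
    λ i → cong suc (trans (sym (f-rotate (last i))) (cong f (rotate-last i)))

A-not-punctually-categorical : ¬ PunctuallyCategorical A
A-not-punctually-categorical categorical =
  let f , f-iso , (p , p≡) , _ = categorical (named rotate) (named-punctual rotate-pr) rotated≅A
      f-rotate i = IsIsomorphism.preserves-op f-iso i []
  in diagonal-≰PR (PR₁⇒≤PR (diagonal-pr
       (rotate-inverse⇒D-pr (p , λ x → p≡ (x ∷ [])) f-rotate)))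

-- The degree of D

bounded-search : (ℕ → ℕ) → ℕ → ℕ → ℕ
bounded-search f zero    x = 0
bounded-search f (suc n) x = ifz (distance (f n) x) n (bounded-search f n x)

bounded-search-pr : PR₁ f → PR₂ (bounded-search f)
bounded-search-pr f-pr = primrec₂ (curry₁ (lit 0)) (λ x → refl)
  (ifz-pr (app₂ distance-pr (app₁ f-pr (var 0F)) (var 2F)) (var 0F) (var 1F))
  (λ n x → refl)

bounded-search-unique : ∀ {m n x} → f m ≡ x → (∀ {k} → f k ≡ x → k ≡ m) → m < n →
                        bounded-search f n x ≡ m
bounded-search-unique {f} {m} {suc n} {x} fm≡x unique m<1+n with distance (f n) x in eq
... | zero  = unique (distance≡0⇒≡ eq)
... | suc _ with m≤n⇒m<n∨m≡n (≤-pred m<1+n)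
...   | inj₁ m<n  = bounded-search-unique fm≡x unique m<n
...   | inj₂ refl =
  contradiction (trans (sym eq) (trans (cong (λ y → distance y x) fm≡x) (distance-refl x))) λ ()

PR₂-with-oracle : ∀ {d} → PR₂ h → PR₁ f → (λ x → h (d (f x)) x) ≤PR d
PR₂-with-oracle {h} {f} {d} (p , p≡) (q , q≡) =
  comp (lift p) (comp (oracle tt) (lift q ∷ []) ∷ proj 0F ∷ []) , λ x → trans
    (eval-lift d p _)
    (trans (p≡ _ x)
      (cong (λ y → h (d y) x) (trans (eval-lift d q (x ∷ [])) (q≡ x))))

A-spectrum-D : PRCatSpec A D
A-spectrum-D B ((F , (p , p≡) , F≡) , (G , (q , q≡) , G≡)) B≅A =
  proj₁ A≅B , proj₂ A≅B , PR₁⇒≤PR name-pr , ≤D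
  where
  A≅B = ≅-sym B≅A
  φ   = proj₁ B≅A

  name-pr : PR₁ (from φ)
  name-pr = let r , r≡ = app₂ (p , λ i c → p≡ (i ∷ c ∷ [])) (var 0F) (lit 0)
    in r , λ i → trans (r≡ (i ∷ [])) (trans (F≡ i []) (constant-name B≅A i))

  -- B's answer to whether U i holds of π₂ i.
  answer : Scheme ⊥ 1
  answer = comp q (proj 0F ∷ proj₁ (app₂ pair-pr (app₁ π₂-pr (var 0F)) (lit 0)) ∷ [])

  index-of : ℕ → ℕ
  index-of x = ⟨ code (lift answer) , x ⟩

  answer≡ : ∀ x → eval (const (const 0)) (lift answer) (index-of x ∷ []) ≡ U (index-of x) (to φ x)
  answer≡ x = begin
    eval (const (const 0)) (lift answer) (i ∷ [])  ≡⟨ eval-lift (const 0) answer (i ∷ []) ⟩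
    eval ⊥-elim answer (i ∷ [])                    ≡⟨ q≡ _ ⟩
    G (i ∷ _ ∷ [])                                 ≡⟨ cong (λ c → G (i ∷ c ∷ [])) argument ⟩
    G (i ∷ pair x 0 ∷ [])                          ≡⟨ G≡ i (x ∷ []) ⟩
    χ B i (x ∷ [])                                 ≡⟨ cong (if_then 1 else 0)
                                                         (preserves-rel i (x ∷ [])) ⟩
    χ A i (to φ x ∷ [])                            ≡⟨ χ-named id i (to φ x) ⟩
    U i (to φ x)                                   ∎
    where
    open ≡-Reasoning
    open IsIsomorphism (proj₂ B≅A)
    i = index-of x

    argument : _ ≡ pair x 0
    argument = trans (proj₂ (app₂ pair-pr (app₁ π₂-pr (var 0F)) (lit 0)) (i ∷ []))
      (trans (⟨,⟩≡pair _ 0) (cong (λ x → pair x 0) (π₂-pair _ x)))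

  bound : ∀ x → to φ x < D (index-of x)
  bound x with to φ x <? D (index-of x)
  ... | yes φx<D = φx<D
  ... | no  φx≮D = contradiction
    (trans (U-late {index-of x} (≮⇒≥ φx≮D))
      (trans (halts⇒diagonal {index-of x} (code-halts (lift answer) (index-of x) (π₁-pair _ x)))
             (cong flip (answer≡ x))))
    (flip-≢ _)

  ≤D : to φ ≤PR D
  ≤D = let Ψ , Ψ≡ = PR₂-with-oracle {d = D} (bounded-search-pr name-pr)
                      (curry₁ (app₂ pair-pr (lit (code (lift answer))) (var 0F)))
    in Ψ , λ x → trans (Ψ≡ x) (bounded-search-unique (strictlyInverseʳ φ x)
         (λ {k} eq → trans (sym (strictlyInverseˡ φ k)) (cong (to φ) eq)) (bound x))

relative-diagonal-computable : Computable (Relative.diagonal ∘ head {n = 0})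
relative-diagonal-computable = PR₁⇒computable
  (curry₁ (ifz-pr (app₁ pred-pr (var 0F)) (lit 1) (lit 0)))
  (PR₂⇒computable Relative.H-pr head-computable D-computable)
  where
  head-computable : Computable {1} head
  head-computable = proj 0F , λ { (x ∷ []) → proj 0F }

  D-computable : Computable (Relative.D ∘ head)
  D-computable = minimization-computable
    (PR₂⇒computable Relative.testD-pr (pr⇒computable (var 1F)) (pr⇒computable (var 0F)))
    (λ { (i ∷ []) → Relative.testD-complete {i} ≤-refl })
    (λ { (i ∷ []) m<D eq → <⇒≱ m<D (Relative.testD-sound {i} eq) })

theorem3p1 : Σ Language λ L → Σ (Structure L) λ A →
    PunctualStructure A ×
    ComputablyCategorical A ×
    (¬ PunctuallyCategorical A) ×
    (PRCatSpec A ⊈ ConeΔ⁰₁)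
theorem3p1 =
  language , A , named-punctual (curry₁ (var 0F)) , A-computably-categorical ,
  A-not-punctually-categorical ,
  λ spec⊆cone → Relative.diagonal-≰PR
    (spec⊆cone A-spectrum-D Relative.diagonal relative-diagonal-computable)
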